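{- There exist constants $c>0$ and $n_0\in\mathbb{N}$ and a set $S\subset \mathbb{Z}^2$ such that no three distinct points of $S$ lie on a common line and \[ |S\cap [n]^2|\geq \frac{cn}{\sqrt{\log n}} \] for all integers $n\geq n_0$.
   Context: For $n\in\mathbb{N}$, $[n]=\{1,2,\dots,n\}$ and $[n]^2=[n]\times[n]\subset\mathbb{Z}^2$. -}

module Defs where

open import Data.Nat using (ℕ; suc)
open import Data.Bool using (Bool; true; false; if_then_else_)
open import Data.List using (List; map; upTo)
open import Data.Nat.ListAction using (sum)
open import Data.Integer using (ℤ; +_; _+_; _*_)
open import Data.Product using (_×_; _,_; ∃; ∃-syntax)
open import Data.Sum using (_⊎_)
open import Relation.Binary.PropositionalEquality using (_≡_; _≢_)
open import Relation.Nullary using (¬_)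

Point : Set
Point = ℤ × ℤ

Subset² : Set
Subset² = Point → Bool

[_] : ℕ → List ℕ
[ n ] = map suc (upTo n)

count : Subset² → ℕ → ℕ
count S n = sum (map (λ i → sum (map (λ j → if S (+ i , + j) then 1 else 0) [ n ])) [ n ])

-- A line in the plane  a x + b y = c  with (a , b) ≠ (0 , 0).
-- Integer coefficients suffice: any line through two distinct lattice points
-- has an equation with integer coefficients.
OnLine : ℤ → ℤ → ℤ → Point → Set
OnLine a b c (x , y) = a * x + b * y ≡ c

Collinear : Point → Point → Point → Set
Collinear P Q R = ∃[ a ] ∃[ b ] ∃[ c ]
  (¬ (a ≡ + 0 × b ≡ + 0) × OnLine a b c P × OnLine a b c Q × OnLine a b c R)

NoThreeInLine : Subset² → Set
NoThreeInLine S = ∀ P Q R → S P ≡ true → S Q ≡ true → S R ≡ true →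
  P ≢ Q → P ≢ R → Q ≢ R → ¬ Collinear P Q R

{-# OPTIONS --safe #-}
module Submission where

-- The set is built greedily. In the box of side N = 2 ^ k, a line through P and Q contains
-- at most about N / D lattice points, where D is the sup norm of the primitive direction of Q − P.
-- For fixed P these weights add up to O(N² log N) over all Q, because Q = P + g d with
-- ∣ g ∣ D ≤ N, there are O(D) directions d of norm D, and Σ_D D (N / D)² = O(N² log N).
-- Keep the total weight of all chosen pairs (the energy) below a small multiple of N². Then the
-- lines through chosen points miss a positive proportion of the box, so by averaging some free
-- point raises the energy by only O(m log N), m being the number of points chosen so far. Hence
-- about N / √(log N) points fit. Passing from N to 2N multiplies every weight by at most 3 and the
-- allowance N² by 4, which leaves room to go on in the next box.

open import Defs
open import Data.Nat
open import Data.Product using (Σ; Σ-syntax; _×_; _,_; proj₁; proj₂; ∃-syntax)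

open import Data.Bool using (Bool; true; false; if_then_else_)
open import Data.Empty using (⊥-elim)
open import Data.Integer as ℤ using (ℤ; +_; -[1+_]; ∣_∣; 0ℤ; 1ℤ; -1ℤ)
import Data.Integer.Properties as ℤ
open import Data.Integer.Tactic.RingSolver using () renaming (solve-∀ to solveℤ-∀)
open import Data.List using (List; []; _∷_; _++_; map; length; upTo; applyUpTo; concatMap; cartesianProductWith)
open import Data.List.Membership.Propositional using (_∈_; _∉_; lose)
open import Data.List.Membership.Propositional.Properties
open import Data.List.Properties using (map-++; map-∘; map-cong; length-upTo)
open import Data.List.Relation.Unary.All using (tabulate)
open import Data.List.Relation.Unary.AllPairs using ([]; _∷_)
open import Data.List.Relation.Unary.Any using (here; there)
open import Data.List.Relation.Unary.Unique.Propositional using (Unique)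
open import Data.List.Relation.Unary.Unique.Propositional.Properties
  using (Unique[x∷xs]⇒x∉xs; cartesianProductWith⁺; upTo⁺)
open import Data.Nat.Divisibility using (divides)
open import Data.Nat.DivMod
open import Data.Nat.GCD using (module GCD; module Bézout)
open import Data.Nat.ListAction using (sum)
open import Data.Nat.ListAction.Properties using (sum-++)
open import Data.Nat.Properties
open import Data.Nat.Tactic.RingSolver using (solve-∀)
open import Data.Product.Properties using (≡-dec)
open import Data.Sum using (_⊎_; inj₁; inj₂)
open import Function using (_∘_)
open import Relation.Binary.Definitions using (DecidableEquality)
open import Relation.Binary.PropositionalEquality hiding ([_])
open import Relation.Nullary using (¬_; Dec; yes; no; does)
open import Relation.Nullary.Decidable using (dec-true)

_≟ₚ_ : DecidableEquality Point
_≟ₚ_ = ≡-dec ℤ._≟_ ℤ._≟_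

open import Data.List.Membership.DecPropositional _≟ₚ_ using (_∈?_)

private variable
  A B C : Set

-- Indicators, finite sums over lists and double counting.

indicator : {P : Set} → Dec P → ℕ
indicator d = if does d then 1 else 0

indicator-yes : {P : Set} (d : Dec P) → P → indicator d ≡ 1
indicator-yes (yes _) _ = refl
indicator-yes (no ¬p) p = ⊥-elim (¬p p)

indicator≡0⇒¬ : {P : Set} (d : Dec P) → indicator d ≡ 0 → ¬ P
indicator≡0⇒¬ d eq p with trans (sym (indicator-yes d p)) eq
... | ()

indicator>0⇒ : {P : Set} (d : Dec P) → 0 < indicator d → P
indicator>0⇒ (yes p) _ = p

-- Opacity keeps ∑ injective for unification.
opaque
  ∑ : List A → (A → ℕ) → ℕ
  ∑ xs f = sum (map f xs)

  ∑-mono : ∀ xs {f g : A → ℕ} → (∀ {x} → x ∈ xs → f x ≤ g x) → ∑ xs f ≤ ∑ xs g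
  ∑-mono []       h = z≤n
  ∑-mono (x ∷ xs) h = +-mono-≤ (h (here refl)) (∑-mono xs (h ∘ there))

  ∑-cong : ∀ xs {f g : A → ℕ} → (∀ x → f x ≡ g x) → ∑ xs f ≡ ∑ xs g
  ∑-cong xs h = cong sum (map-cong h xs)

  ∑-distrib-+ : ∀ xs (f g : A → ℕ) → ∑ xs (λ x → f x + g x) ≡ ∑ xs f + ∑ xs g
  ∑-distrib-+ []       f g = refl
  ∑-distrib-+ (x ∷ xs) f g rewrite ∑-distrib-+ xs f g = interchange (f x) (g x) (∑ xs f) (∑ xs g)
    where
    interchange : ∀ a b c d → a + b + (c + d) ≡ a + c + (b + d)
    interchange = solve-∀

  ∑-*ʳ : ∀ xs (f : A → ℕ) c → ∑ xs (λ x → f x * c) ≡ ∑ xs f * c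
  ∑-*ʳ []       f c = refl
  ∑-*ʳ (x ∷ xs) f c rewrite ∑-*ʳ xs f c = sym (*-distribʳ-+ c (f x) (∑ xs f))

  ∑-const : ∀ (xs : List A) c → ∑ xs (λ _ → c) ≡ length xs * c
  ∑-const []       c = refl
  ∑-const (x ∷ xs) c = cong (λ s → c + s) (∑-const xs c)

  ∑-zero : ∀ (xs : List A) → ∑ xs (λ _ → 0) ≡ 0
  ∑-zero xs = trans (∑-const xs 0) (*-zeroʳ (length xs))

  ∑-∈ : ∀ {x xs} (f : A → ℕ) → x ∈ xs → f x ≤ ∑ xs f
  ∑-∈ f (here refl) = m≤m+n _ _
  ∑-∈ f (there x∈)  = ≤-trans (∑-∈ f x∈) (m≤n+m _ _)

  ∑-++ : ∀ xs ys (f : A → ℕ) → ∑ (xs ++ ys) f ≡ ∑ xs f + ∑ ys f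
  ∑-++ xs ys f = trans (cong sum (map-++ f xs ys)) (sum-++ (map f xs) (map f ys))

  ∑-map : ∀ (g : B → A) xs (f : A → ℕ) → ∑ (map g xs) f ≡ ∑ xs (f ∘ g)
  ∑-map g xs f = cong sum (sym (map-∘ xs))

  ∑-concatMap : ∀ (g : B → List A) xs (f : A → ℕ) →
                ∑ (concatMap g xs) f ≡ ∑ xs (λ x → ∑ (g x) f)
  ∑-concatMap g []       f = refl
  ∑-concatMap g (x ∷ xs) f =
    trans (∑-++ (g x) (concatMap g xs) f) (cong (λ s → ∑ (g x) f + s) (∑-concatMap g xs f))

  ∑-cartesianProductWith : ∀ (g : B → C → A) xs ys (f : A → ℕ) →
    ∑ (cartesianProductWith g xs ys) f ≡ ∑ xs (λ x → ∑ ys (λ y → f (g x y)))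
  ∑-cartesianProductWith g []       ys f = refl
  ∑-cartesianProductWith g (x ∷ xs) ys f =
    trans (∑-++ (map (g x) ys) _ f)
          (cong₂ _+_ (∑-map (g x) ys f) (∑-cartesianProductWith g xs ys f))

  ∑-swap : ∀ xs ys (f : A → B → ℕ) →
           ∑ xs (λ x → ∑ ys (λ y → f x y)) ≡ ∑ ys (λ y → ∑ xs (λ x → f x y))
  ∑-swap []       ys f = sym (∑-zero ys)
  ∑-swap (x ∷ xs) ys f =
    trans (cong (λ s → ∑ ys (f x) + s) (∑-swap xs ys f)) (sym (∑-distrib-+ ys (f x) _))

  ∃-below-average : ∀ xs (f : A → ℕ) γ → ∑ xs f < length xs * γ → ∃[ x ] (x ∈ xs × f x < γ)
  ∃-below-average (x ∷ xs) f γ lt with f x <? γ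
  ... | yes fx<γ = x , here refl , fx<γ
  ... | no  fx≮γ =
    let y , y∈ , fy = ∃-below-average xs f γ
                        (+-cancelˡ-< (f x) _ _ (<-≤-trans lt (+-monoˡ-≤ _ (≮⇒≥ fx≮γ))))
    in y , there y∈ , fy

module _ (_≟ᴬ_ : DecidableEquality A) where

  opaque
    unfolding ∑

    ∑-indicator-∉ : ∀ xs z → z ∉ xs → ∑ xs (λ x → indicator (x ≟ᴬ z)) ≡ 0
    ∑-indicator-∉ []       z z∉ = refl
    ∑-indicator-∉ (x ∷ xs) z z∉ with x ≟ᴬ z
    ... | yes refl = ⊥-elim (z∉ (here refl))
    ... | no  _    = ∑-indicator-∉ xs z (z∉ ∘ there)

    ∑-indicator-≤1 : ∀ {xs} z → Unique xs → ∑ xs (λ x → indicator (x ≟ᴬ z)) ≤ 1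
    ∑-indicator-≤1 z []                  = z≤n
    ∑-indicator-≤1 {x ∷ xs} z u@(_ ∷ us) with x ≟ᴬ z
    ... | yes refl = ≤-reflexive (cong suc (∑-indicator-∉ xs z (Unique[x∷xs]⇒x∉xs u)))
    ... | no  _    = ∑-indicator-≤1 z us

  -- Double counting by charging. Every `x` with `h x` positive is charged to an index `y` with
  -- `x ≡ f y`, and, since `xs` has no repetitions, no index is charged twice. Sums over points
  -- thereby become sums over parameters.
  ∑-cover : ∀ {xs} → Unique xs → (h : A → ℕ) (ys : List B) (f : B → A) (c : B → ℕ) →
            (∀ {x} → x ∈ xs → 0 < h x → ∃[ y ] (y ∈ ys × x ≡ f y × h x ≤ c y)) →
            ∑ xs h ≤ ∑ ys c
  ∑-cover {B} {xs} u h ys f c covered = begin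
    ∑ xs h                                                  ≤⟨ ∑-mono xs pointwise ⟩
    ∑ xs (λ x → ∑ ys (λ y → indicator (x ≟ᴬ f y) * c y))    ≡⟨ ∑-swap xs ys _ ⟩
    ∑ ys (λ y → ∑ xs (λ x → indicator (x ≟ᴬ f y) * c y))    ≤⟨ ∑-mono ys (λ {y} _ → columnwise y) ⟩
    ∑ ys c                                                  ∎
    where
    open ≤-Reasoning
    pointwise : ∀ {x} → x ∈ xs → h x ≤ ∑ ys (λ y → indicator (x ≟ᴬ f y) * c y)
    pointwise {x} x∈ with h x in eq
    ... | zero  = z≤n
    ... | suc k with covered x∈ (subst (0 <_) (sym eq) z<s)
    ...   | y , y∈ , x≡fy , hx≤cy = begin
      suc k                       ≡⟨ eq ⟨
      h x                         ≤⟨ hx≤cy ⟩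
      c y                         ≡⟨ *-identityˡ (c y) ⟨
      1 * c y                     ≡⟨ cong (_* c y) (indicator-yes (x ≟ᴬ f y) x≡fy) ⟨
      indicator (x ≟ᴬ f y) * c y  ≤⟨ ∑-∈ _ y∈ ⟩
      ∑ ys (λ y → indicator (x ≟ᴬ f y) * c y) ∎
    columnwise : ∀ y → ∑ xs (λ x → indicator (x ≟ᴬ f y) * c y) ≤ c y
    columnwise y = begin
      ∑ xs (λ x → indicator (x ≟ᴬ f y) * c y) ≡⟨ ∑-*ʳ xs _ (c y) ⟩
      ∑ xs (λ x → indicator (x ≟ᴬ f y)) * c y ≤⟨ *-monoˡ-≤ (c y) (∑-indicator-≤1 (f y) u) ⟩
      1 * c y                                 ≡⟨ *-identityˡ (c y) ⟩
      c y                                     ∎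

-- Primitive directions of lattice vectors.

-- (b , r , e) stands for the vector (r + 1 , e), with coordinates exchanged if b is true.
Direction : Set
Direction = Bool × ℕ × ℤ

sup-norm-1 : Direction → ℕ
sup-norm-1 (_ , r , _) = r

other : Direction → ℤ
other (_ , _ , e) = e

vector : Direction → Point
vector (false , r , e) = + suc r , e
vector (true  , r , e) = e , + suc r

-- The zero vector gets multiple 0, and then unit forces the direction to have norm 1.
record Factorisation (x y : ℤ) : Set where
  field
    direction : Direction
    multiple  : ℤ
    u w       : ℤ
    small     : ∣ other direction ∣ ≤ suc (sup-norm-1 direction)
    x≡        : x ≡ multiple ℤ.* proj₁ (vector direction)
    y≡        : y ≡ multiple ℤ.* proj₂ (vector direction)
    bézout    : u ℤ.* proj₁ (vector direction) ℤ.+ w ℤ.* proj₂ (vector direction) ≡ 1ℤ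
    unit      : multiple ≡ 0ℤ → sup-norm-1 direction ≡ 0

sign-abs : ∀ i → ∃[ s ] (s ℤ.* s ≡ 1ℤ × ∣ s ∣ ≡ 1 × i ≡ s ℤ.* + ∣ i ∣)
sign-abs (+ n)    = 1ℤ , refl , refl , sym (ℤ.*-identityˡ (+ n))
sign-abs -[1+ n ] = -1ℤ , refl , refl , sym (ℤ.-1*i≡-i (+ suc n))

bézout-ℤ : ∀ a b x y → 1 + y * b ≡ x * a → + x ℤ.* + a ℤ.+ ℤ.- + y ℤ.* + b ≡ 1ℤ
bézout-ℤ a b x y eq = begin
  + x ℤ.* + a ℤ.+ ℤ.- + y ℤ.* + b              ≡⟨ cong (ℤ._+ ℤ.- + y ℤ.* + b) (ℤ.pos-* x a) ⟨
  + (x * a) ℤ.+ ℤ.- + y ℤ.* + b                ≡⟨ cong (λ z → + z ℤ.+ ℤ.- + y ℤ.* + b) eq ⟨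
  1ℤ ℤ.+ + (y * b) ℤ.+ ℤ.- + y ℤ.* + b         ≡⟨ cong (λ z → 1ℤ ℤ.+ z ℤ.+ ℤ.- + y ℤ.* + b) (ℤ.pos-* y b) ⟩
  1ℤ ℤ.+ + y ℤ.* + b ℤ.+ ℤ.- + y ℤ.* + b       ≡⟨ identity (+ y) (+ b) ⟩
  1ℤ                                           ∎
  where
  open ≡-Reasoning
  identity : ∀ y b → 1ℤ ℤ.+ y ℤ.* b ℤ.+ ℤ.- y ℤ.* b ≡ 1ℤ
  identity = solveℤ-∀

-- The quotients by the gcd `d` inherit its Bézout coefficients after cancelling `d`, which is
-- nonzero because `m` is.
coprime-quotients : ∀ m n .{{_ : NonZero m}} → ∃[ a ] ∃[ b ] ∃[ d ] ∃[ u ] ∃[ w ]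
  (m ≡ a * d × n ≡ b * d × u ℤ.* + a ℤ.+ w ℤ.* + b ≡ 1ℤ)
coprime-quotients m n with Bézout.lemma m n
... | Bézout.result zero (GCD.is (divides a m≡ , _) _) _ =
  ⊥-elim (≢-nonZero⁻¹ m (trans m≡ (*-zeroʳ a)))
... | Bézout.result d@(suc _) (GCD.is (divides a m≡ , divides b n≡) _) (Bézout.+- x y eq) =
  a , b , d , + x , ℤ.- + y , m≡ , n≡ , bézout-ℤ a b x y
    (*-cancelʳ-≡ _ _ d (trans (cong (λ z → d + z) (*-assoc y b d))
      (trans (cong (λ z → d + y * z) (sym n≡))
        (trans eq (trans (cong (x *_) m≡) (sym (*-assoc x a d)))))))
... | Bézout.result d@(suc _) (GCD.is (divides a m≡ , divides b n≡) _) (Bézout.-+ x y eq) =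
  a , b , d , ℤ.- + x , + y , m≡ , n≡ , trans (ℤ.+-comm (ℤ.- + x ℤ.* + a) _) (bézout-ℤ b a y x
    (*-cancelʳ-≡ _ _ d (trans (cong (λ z → d + z) (*-assoc x a d))
      (trans (cong (λ z → d + x * z) (sym m≡))
        (trans eq (trans (cong (y *_) n≡) (sym (*-assoc y b d))))))))

factorise-wide : ∀ x y → ∣ y ∣ ≤ ∣ x ∣ → Factorisation x y
factorise-wide x y y≤x with ∣ x ∣ ≟ 0
... | yes ∣x∣≡0 = record
  { direction = false , 0 , 0ℤ ; multiple = 0ℤ ; u = 1ℤ ; w = 0ℤ
  ; small = z≤n
  ; x≡ = ℤ.∣i∣≡0⇒i≡0 ∣x∣≡0
  ; y≡ = ℤ.∣i∣≡0⇒i≡0 (n≤0⇒n≡0 (≤-trans y≤x (≤-reflexive ∣x∣≡0)))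
  ; bézout = refl
  ; unit = λ _ → refl }
... | no ∣x∣≢0 with coprime-quotients ∣ x ∣ ∣ y ∣ {{≢-nonZero ∣x∣≢0}} | sign-abs x | sign-abs y
...   | zero , _ , _ , _ , _ , x≡ , _ | _ | _ = ⊥-elim (∣x∣≢0 x≡)
...   | suc a , b , zero , _ , _ , x≡ , _ | _ | _ = ⊥-elim (∣x∣≢0 (trans x≡ (*-zeroʳ a)))
...   | suc a , b , d@(suc _) , u , w , ∣x∣≡ , ∣y∣≡ , bez | s , ss , ∣s∣ , x≡ | s′ , ss′ , ∣s′∣ , y≡ = record
  -- The sign of `x` goes into the multiple, which keeps the first coordinate positive; the second
  -- coordinate, and with it the Bézout coefficient `w`, then carries the product of both signs.
  { direction = false , a , s ℤ.* s′ ℤ.* + b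
  ; multiple = s ℤ.* + d
  ; u = u ; w = w ℤ.* s ℤ.* s′
  ; small = subst (_≤ suc a) (sym ∣ss′b∣) (*-cancelʳ-≤ b (suc a) d (subst₂ _≤_ ∣y∣≡ ∣x∣≡ y≤x))
  ; x≡ = begin
      x                                  ≡⟨ x≡ ⟩
      s ℤ.* + ∣ x ∣                      ≡⟨ cong (λ z → s ℤ.* + z) (trans ∣x∣≡ (*-comm (suc a) d)) ⟩
      s ℤ.* + (d * suc a)                ≡⟨ cong (s ℤ.*_) (ℤ.pos-* d (suc a)) ⟩
      s ℤ.* (+ d ℤ.* + suc a)            ≡⟨ ℤ.*-assoc s (+ d) (+ suc a) ⟨
      s ℤ.* + d ℤ.* + suc a              ∎
  ; y≡ = begin
      y                                  ≡⟨ y≡ ⟩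
      s′ ℤ.* + ∣ y ∣                     ≡⟨ cong (λ z → s′ ℤ.* + z) ∣y∣≡ ⟩
      s′ ℤ.* + (b * d)                   ≡⟨ cong (s′ ℤ.*_) (ℤ.pos-* b d) ⟩
      s′ ℤ.* (+ b ℤ.* + d)               ≡⟨ ℤ.*-identityˡ _ ⟨
      1ℤ ℤ.* (s′ ℤ.* (+ b ℤ.* + d))      ≡⟨ cong (ℤ._* (s′ ℤ.* (+ b ℤ.* + d))) ss ⟨
      s ℤ.* s ℤ.* (s′ ℤ.* (+ b ℤ.* + d)) ≡⟨ reorder s s′ (+ b) (+ d) ⟩
      s ℤ.* + d ℤ.* (s ℤ.* s′ ℤ.* + b)   ∎
  ; bézout = begin
      u ℤ.* + suc a ℤ.+ w ℤ.* s ℤ.* s′ ℤ.* (s ℤ.* s′ ℤ.* + b)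
        ≡⟨ cong (λ z → u ℤ.* + suc a ℤ.+ z) (collect s s′ w (+ b)) ⟩
      u ℤ.* + suc a ℤ.+ s ℤ.* s ℤ.* (s′ ℤ.* s′) ℤ.* (w ℤ.* + b)
        ≡⟨ cong₂ (λ p q → u ℤ.* + suc a ℤ.+ p ℤ.* q ℤ.* (w ℤ.* + b)) ss ss′ ⟩
      u ℤ.* + suc a ℤ.+ 1ℤ ℤ.* (w ℤ.* + b)
        ≡⟨ cong (λ z → u ℤ.* + suc a ℤ.+ z) (ℤ.*-identityˡ (w ℤ.* + b)) ⟩
      u ℤ.* + suc a ℤ.+ w ℤ.* + b  ≡⟨ bez ⟩
      1ℤ ∎
  ; unit = λ eq → ⊥-elim (1+n≢0 (trans (sym (trans (ℤ.abs-* s (+ d)) (trans (cong (_* d) ∣s∣) (*-identityˡ d)))) (cong ∣_∣ eq)))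
  }
  where
  open ≡-Reasoning
  reorder : ∀ s s′ b d → s ℤ.* s ℤ.* (s′ ℤ.* (b ℤ.* d)) ≡ s ℤ.* d ℤ.* (s ℤ.* s′ ℤ.* b)
  reorder = solveℤ-∀
  collect : ∀ s s′ w b → w ℤ.* s ℤ.* s′ ℤ.* (s ℤ.* s′ ℤ.* b) ≡ s ℤ.* s ℤ.* (s′ ℤ.* s′) ℤ.* (w ℤ.* b)
  collect = solveℤ-∀
  ∣ss′b∣ : ∣ s ℤ.* s′ ℤ.* + b ∣ ≡ b
  ∣ss′b∣ = begin
    ∣ s ℤ.* s′ ℤ.* + b ∣    ≡⟨ ℤ.abs-* (s ℤ.* s′) (+ b) ⟩
    ∣ s ℤ.* s′ ∣ * b        ≡⟨ cong (_* b) (ℤ.abs-* s s′) ⟩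
    ∣ s ∣ * ∣ s′ ∣ * b      ≡⟨ cong₂ (λ p q → p * q * b) ∣s∣ ∣s′∣ ⟩
    1 * 1 * b               ≡⟨ *-identityˡ b ⟩
    b                       ∎

factorise : ∀ x y → Factorisation x y
factorise x y with ≤-total ∣ y ∣ ∣ x ∣
... | inj₁ y≤x = factorise-wide x y y≤x
... | inj₂ x≤y with factorise-wide y x x≤y
...   | record { direction = false , r , e ; multiple = g ; u = u ; w = w ; small = small
               ; x≡ = x≡ ; y≡ = y≡ ; bézout = bézout ; unit = unit } =
  record { direction = true , r , e ; multiple = g ; u = w ; w = u ; small = small
         ; x≡ = y≡ ; y≡ = x≡ ; bézout = trans (ℤ.+-comm (w ℤ.* e) (u ℤ.* + suc r)) bézout ; unit = unit }
...   | record { direction = true , r , e ; multiple = g ; u = u ; w = w ; small = small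
               ; x≡ = x≡ ; y≡ = y≡ ; bézout = bézout ; unit = unit } =
  record { direction = false , r , e ; multiple = g ; u = w ; w = u ; small = small
         ; x≡ = y≡ ; y≡ = x≡ ; bézout = trans (ℤ.+-comm (w ℤ.* + suc r) (u ℤ.* e)) bézout ; unit = unit }

open Factorisation

-- Collinearity, the cross product and parametrised lattice lines.

along : Point → Point → ℤ → Point
along (x , y) (a , b) t = x ℤ.+ t ℤ.* a , y ℤ.+ t ℤ.* b

cross : Point → Point → Point → ℤ
cross (x₀ , y₀) (x₁ , y₁) (x₂ , y₂) =
  (x₁ ℤ.- x₀) ℤ.* (y₂ ℤ.- y₀) ℤ.- (y₁ ℤ.- y₀) ℤ.* (x₂ ℤ.- x₀)

-- Cramer's rule: subtracting the equation at `P` from those at `Q` and `R` gives two homogeneous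
-- equations in `(a , b)` whose determinant is the cross product. Both `a` and `b` annihilate it,
-- and they are not both zero.
collinear⇒cross≡0 : ∀ P Q R → Collinear P Q R → cross P Q R ≡ 0ℤ
collinear⇒cross≡0 P@(x₀ , y₀) Q@(x₁ , y₁) R@(x₂ , y₂) (a , b , c , ab≢0 , onP , onQ , onR) =
  conclude (ℤ.i*j≡0⇒i≡0∨j≡0 a {cross P Q R} a*cross≡0) (ℤ.i*j≡0⇒i≡0∨j≡0 b {cross P Q R} b*cross≡0)
  where
  collect : ∀ a b x₀ y₀ x y → a ℤ.* (x ℤ.- x₀) ℤ.+ b ℤ.* (y ℤ.- y₀) ≡
                              (a ℤ.* x ℤ.+ b ℤ.* y) ℤ.- (a ℤ.* x₀ ℤ.+ b ℤ.* y₀)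
  collect = solveℤ-∀
  difference : ∀ {x y} → a ℤ.* x ℤ.+ b ℤ.* y ≡ c → a ℤ.* (x ℤ.- x₀) ℤ.+ b ℤ.* (y ℤ.- y₀) ≡ 0ℤ
  difference {x} {y} on = trans (collect a b x₀ y₀ x y) (ℤ.i≡j⇒i-j≡0 (trans on (sym onP)))
  expandᵃ : ∀ a b p q r s → a ℤ.* (p ℤ.* s ℤ.- q ℤ.* r) ≡
                            s ℤ.* (a ℤ.* p ℤ.+ b ℤ.* q) ℤ.- q ℤ.* (a ℤ.* r ℤ.+ b ℤ.* s)
  expandᵃ = solveℤ-∀
  expandᵇ : ∀ a b p q r s → b ℤ.* (p ℤ.* s ℤ.- q ℤ.* r) ≡
                            p ℤ.* (a ℤ.* r ℤ.+ b ℤ.* s) ℤ.- r ℤ.* (a ℤ.* p ℤ.+ b ℤ.* q)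
  expandᵇ = solveℤ-∀
  vanish : ∀ s q → s ℤ.* 0ℤ ℤ.- q ℤ.* 0ℤ ≡ 0ℤ
  vanish = solveℤ-∀
  a*cross≡0 : a ℤ.* cross P Q R ≡ 0ℤ
  a*cross≡0 = trans (expandᵃ a b (x₁ ℤ.- x₀) (y₁ ℤ.- y₀) (x₂ ℤ.- x₀) (y₂ ℤ.- y₀))
    (trans (cong₂ (λ p q → (y₂ ℤ.- y₀) ℤ.* p ℤ.- (y₁ ℤ.- y₀) ℤ.* q) (difference onQ) (difference onR))
           (vanish (y₂ ℤ.- y₀) (y₁ ℤ.- y₀)))
  b*cross≡0 : b ℤ.* cross P Q R ≡ 0ℤ
  b*cross≡0 = trans (expandᵇ a b (x₁ ℤ.- x₀) (y₁ ℤ.- y₀) (x₂ ℤ.- x₀) (y₂ ℤ.- y₀))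
    (trans (cong₂ (λ p q → (x₁ ℤ.- x₀) ℤ.* p ℤ.- (x₂ ℤ.- x₀) ℤ.* q) (difference onR) (difference onQ))
           (vanish (x₁ ℤ.- x₀) (x₂ ℤ.- x₀)))
  conclude : a ≡ 0ℤ ⊎ cross P Q R ≡ 0ℤ → b ≡ 0ℤ ⊎ cross P Q R ≡ 0ℤ → cross P Q R ≡ 0ℤ
  conclude (inj₂ eq)  _          = eq
  conclude (inj₁ _)   (inj₂ eq)  = eq
  conclude (inj₁ a≡0) (inj₁ b≡0) = ⊥-elim (ab≢0 (a≡0 , b≡0))

step : (P Q : Point) → Factorisation (proj₁ Q ℤ.- proj₁ P) (proj₂ Q ℤ.- proj₂ P)
step P Q = factorise _ _

x≡x₀+Δ : ∀ x x₀ {d} → x ℤ.- x₀ ≡ d → x ≡ x₀ ℤ.+ d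
x≡x₀+Δ x x₀ refl = identity x x₀
  where
  identity : ∀ x x₀ → x ≡ x₀ ℤ.+ (x ℤ.- x₀)
  identity = solveℤ-∀

step-along : ∀ P Q → Q ≡ along P (vector (direction (step P Q))) (multiple (step P Q))
step-along P@(x₀ , y₀) Q@(x , y) = cong₂ _,_ (x≡x₀+Δ x x₀ (x≡ (step P Q))) (x≡x₀+Δ y y₀ (y≡ (step P Q)))

-- A vector `(ex , ey)` parallel to a primitive `(a , b)` is an integer multiple of it: since
-- `U * a + W * b` is 1, the multiple is `U * ex + W * ey`. The factor `g` of `Q - P` cancels
-- because `P ≢ Q`.
cross≡0⇒along : ∀ P Q X → P ≢ Q → cross P Q X ≡ 0ℤ →
                ∃[ t ] X ≡ along P (vector (direction (step P Q))) t
cross≡0⇒along P@(x₀ , y₀) Q@(x₁ , y₁) X@(x , y) P≢Q cr =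
  conclude (ℤ.i*j≡0⇒i≡0∨j≡0 g {a ℤ.* ey ℤ.- b ℤ.* ex} g*≡0)
  where
  open ≡-Reasoning
  g = multiple (step P Q)
  a = proj₁ (vector (direction (step P Q)))
  b = proj₂ (vector (direction (step P Q)))
  ex = x ℤ.- x₀
  ey = y ℤ.- y₀
  factor : ∀ g a b ex ey → g ℤ.* (a ℤ.* ey ℤ.- b ℤ.* ex) ≡ g ℤ.* a ℤ.* ey ℤ.- g ℤ.* b ℤ.* ex
  factor = solveℤ-∀
  g*≡0 : g ℤ.* (a ℤ.* ey ℤ.- b ℤ.* ex) ≡ 0ℤ
  g*≡0 = begin
    g ℤ.* (a ℤ.* ey ℤ.- b ℤ.* ex)          ≡⟨ factor g a b ex ey ⟩
    g ℤ.* a ℤ.* ey ℤ.- g ℤ.* b ℤ.* ex      ≡⟨ cong₂ (λ p q → p ℤ.* ey ℤ.- q ℤ.* ex) (x≡ (step P Q)) (y≡ (step P Q)) ⟨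
    cross P Q X                            ≡⟨ cr ⟩
    0ℤ                                     ∎
  U = u (step P Q)
  W = w (step P Q)
  t = U ℤ.* ex ℤ.+ W ℤ.* ey
  rearrangeˣ : ∀ U W a b ex ey → ex ℤ.* (U ℤ.* a ℤ.+ W ℤ.* b) ≡
                                 (U ℤ.* ex ℤ.+ W ℤ.* ey) ℤ.* a ℤ.- W ℤ.* (a ℤ.* ey ℤ.- b ℤ.* ex)
  rearrangeˣ = solveℤ-∀
  rearrangeʸ : ∀ U W a b ex ey → ey ℤ.* (U ℤ.* a ℤ.+ W ℤ.* b) ≡
                                 (U ℤ.* ex ℤ.+ W ℤ.* ey) ℤ.* b ℤ.- ℤ.- U ℤ.* (a ℤ.* ey ℤ.- b ℤ.* ex)
  rearrangeʸ = solveℤ-∀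
  drop-zero : ∀ p W → p ℤ.- W ℤ.* 0ℤ ≡ p
  drop-zero = solveℤ-∀
  ex≡ : a ℤ.* ey ℤ.- b ℤ.* ex ≡ 0ℤ → ex ≡ t ℤ.* a
  ex≡ d×e≡0 = begin
    ex                                         ≡⟨ ℤ.*-identityʳ ex ⟨
    ex ℤ.* 1ℤ                                  ≡⟨ cong (ex ℤ.*_) (bézout (step P Q)) ⟨
    ex ℤ.* (U ℤ.* a ℤ.+ W ℤ.* b)               ≡⟨ rearrangeˣ U W a b ex ey ⟩
    t ℤ.* a ℤ.- W ℤ.* (a ℤ.* ey ℤ.- b ℤ.* ex)  ≡⟨ cong (λ z → t ℤ.* a ℤ.- W ℤ.* z) d×e≡0 ⟩
    t ℤ.* a ℤ.- W ℤ.* 0ℤ                       ≡⟨ drop-zero (t ℤ.* a) W ⟩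
    t ℤ.* a                                    ∎
  ey≡ : a ℤ.* ey ℤ.- b ℤ.* ex ≡ 0ℤ → ey ≡ t ℤ.* b
  ey≡ d×e≡0 = begin
    ey                                         ≡⟨ ℤ.*-identityʳ ey ⟨
    ey ℤ.* 1ℤ                                  ≡⟨ cong (ey ℤ.*_) (bézout (step P Q)) ⟨
    ey ℤ.* (U ℤ.* a ℤ.+ W ℤ.* b)               ≡⟨ rearrangeʸ U W a b ex ey ⟩
    t ℤ.* b ℤ.- ℤ.- U ℤ.* (a ℤ.* ey ℤ.- b ℤ.* ex)  ≡⟨ cong (λ z → t ℤ.* b ℤ.- ℤ.- U ℤ.* z) d×e≡0 ⟩
    t ℤ.* b ℤ.- ℤ.- U ℤ.* 0ℤ                   ≡⟨ drop-zero (t ℤ.* b) (ℤ.- U) ⟩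
    t ℤ.* b                                    ∎
  coincide : ∀ {z z₀ d} → g ≡ 0ℤ → z ℤ.- z₀ ≡ g ℤ.* d → z₀ ≡ z
  coincide {z} {z₀} {d} g≡0 eq =
    sym (ℤ.i-j≡0⇒i≡j z z₀ (trans eq (trans (cong (ℤ._* d) g≡0) (ℤ.*-zeroˡ d))))
  conclude : g ≡ 0ℤ ⊎ a ℤ.* ey ℤ.- b ℤ.* ex ≡ 0ℤ → ∃[ t ] X ≡ along P (vector (direction (step P Q))) t
  conclude (inj₁ g≡0) = ⊥-elim (P≢Q (cong₂ _,_ (coincide g≡0 (x≡ (step P Q))) (coincide g≡0 (y≡ (step P Q)))))
  conclude (inj₂ d×e≡0) = t , cong₂ _,_ (x≡x₀+Δ x x₀ (ex≡ d×e≡0)) (x≡x₀+Δ y y₀ (ey≡ d×e≡0))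

-- Counting the points of a line in a box.

InBox : ℕ → Point → Set
InBox L P = ∃[ i ] ∃[ j ] (P ≡ (+ suc i , + suc j) × i < L × j < L)

∣m-n∣≤ : ∀ {L m n} → m ≤ L → n ≤ L → ∣ + m ℤ.- + n ∣ ≤ L
∣m-n∣≤ {L} {m} {n} m≤L n≤L = begin
  ∣ + m ℤ.- + n ∣  ≡⟨ cong ∣_∣ (ℤ.m-n≡m⊖n m n) ⟩
  ∣ m ℤ.⊖ n ∣      ≤⟨ ℤ.∣m⊝n∣≤m⊔n m n ⟩
  m ⊔ n            ≤⟨ ⊔-lub m≤L n≤L ⟩
  L                ∎
  where open ≤-Reasoning

-- A direction has a coordinate equal to its sup norm, so this coordinate bounds the multiple.
along-bound : ∀ {L P Q} d t → InBox L P → InBox L Q → Q ≡ along P (vector d) t →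
              ∣ t ∣ * suc (sup-norm-1 d) ≤ L
along-bound {L} {P} {Q} d t (i , j , refl , i<L , j<L) (i′ , j′ , refl , i′<L , j′<L) eq = go d eq
  where
  open ≤-Reasoning
  cancel : ∀ x t a → x ℤ.+ t ℤ.* a ℤ.- x ≡ t ℤ.* a
  cancel = solveℤ-∀
  coordinate : ∀ {x x′} r → x < L → x′ < L → + suc x′ ≡ + suc x ℤ.+ t ℤ.* + suc r → ∣ t ∣ * suc r ≤ L
  coordinate {x} {x′} r x<L x′<L e = begin
    ∣ t ∣ * suc r                              ≡⟨ ℤ.abs-* t (+ suc r) ⟨
    ∣ t ℤ.* + suc r ∣                          ≡⟨ cong ∣_∣ (cancel (+ suc x) t (+ suc r)) ⟨
    ∣ + suc x ℤ.+ t ℤ.* + suc r ℤ.- + suc x ∣  ≡⟨ cong (λ z → ∣ z ℤ.- + suc x ∣) e ⟨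
    ∣ + suc x′ ℤ.- + suc x ∣                   ≤⟨ ∣m-n∣≤ x′<L x<L ⟩
    L                                          ∎
  go : ∀ d → (+ suc i′ , + suc j′) ≡ along (+ suc i , + suc j) (vector d) t → ∣ t ∣ * suc (sup-norm-1 d) ≤ L
  go (false , r , e) eq = coordinate r i<L i′<L (cong proj₁ eq)
  go (true  , r , e) eq = coordinate r j<L j′<L (cong proj₂ eq)

m*n≤o⇒m≤o/n : ∀ m n {o} .{{_ : NonZero n}} → m * n ≤ o → m ≤ o / n
m*n≤o⇒m≤o/n m n le = subst (_≤ _) (m*n/n≡m m n) (/-monoˡ-≤ n le)

along-bound-/ : ∀ {L P Q} d t → InBox L P → InBox L Q → Q ≡ along P (vector d) t →
                ∣ t ∣ ≤ L / suc (sup-norm-1 d)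
along-bound-/ d t inP inQ eq = m*n≤o⇒m≤o/n ∣ t ∣ _ (along-bound d t inP inQ eq)

-- Zero is listed twice, once for each sign; this is harmless in a covering list and makes the
-- length `2 + 2 * M`.
range : ℕ → List ℤ
range M = map (λ i → + i) (upTo (suc M)) ++ map (λ i → ℤ.- + i) (upTo (suc M))

∈-range : ∀ {M} z → ∣ z ∣ ≤ M → z ∈ range M
∈-range (+ n)    le = ∈-++⁺ˡ (∈-map⁺ (λ i → + i) (∈-upTo⁺ (s≤s le)))
∈-range -[1+ n ] le = ∈-++⁺ʳ (map (λ i → + i) (upTo (suc _))) (∈-map⁺ (λ i → ℤ.- + i) {x = suc n} (∈-upTo⁺ (s≤s le)))

∑-range : ∀ M c → ∑ (range M) (λ _ → c) ≡ (2 + 2 * M) * c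
∑-range M c = trans (∑-++ (map (λ i → + i) (upTo (suc M))) _ _)
  (trans (cong₂ _+_ (half (λ i → + i)) (half (λ i → ℤ.- + i))) (identity M c))
  where
  half : ∀ f → ∑ (map f (upTo (suc M))) (λ _ → c) ≡ suc M * c
  half f = trans (∑-map f (upTo (suc M)) _)
                 (trans (∑-const (upTo (suc M)) c) (cong (_* c) (length-upTo (suc M))))
  identity : ∀ M c → suc M * c + suc M * c ≡ (2 + 2 * M) * c
  identity = solve-∀

-- This is the length of `range (N / D)`, `D` being the sup norm of the primitive direction: a bound
-- for the number of admissible parameters on the line through `P` and `Q`.
weight : ℕ → Point → Point → ℕ
weight N P Q = 2 + 2 * (N / suc (sup-norm-1 (direction (step P Q))))

line-≤-weight : ∀ {N xs P Q} → Unique xs → (∀ {X} → X ∈ xs → InBox N X) → InBox N P → P ≢ Q →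
                ∑ xs (λ X → indicator (cross P Q X ℤ.≟ 0ℤ)) ≤ weight N P Q
line-≤-weight {N} {xs} {P} {Q} u inB inP P≢Q = begin
  ∑ xs (λ X → indicator (cross P Q X ℤ.≟ 0ℤ))
    ≤⟨ ∑-cover _≟ₚ_ u _ (range M) (along P (vector d)) (λ _ → 1) covered ⟩
  ∑ (range M) (λ _ → 1)   ≡⟨ ∑-range M 1 ⟩
  (2 + 2 * M) * 1         ≡⟨ *-identityʳ (2 + 2 * M) ⟩
  weight N P Q            ∎
  where
  open ≤-Reasoning
  d = direction (step P Q)
  M = N / suc (sup-norm-1 d)
  covered : ∀ {X} → X ∈ xs → 0 < indicator (cross P Q X ℤ.≟ 0ℤ) →
            ∃[ t ] (t ∈ range M × X ≡ along P (vector d) t × indicator (cross P Q X ℤ.≟ 0ℤ) ≤ 1)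
  covered {X} X∈ pos =
    let cr = indicator>0⇒ (cross P Q X ℤ.≟ 0ℤ) pos
        t , eq = cross≡0⇒along P Q X P≢Q cr
    in t , ∈-range t (along-bound-/ d t inP (inB X∈) eq) , eq , ≤-reflexive (indicator-yes (cross P Q X ℤ.≟ 0ℤ) cr)

m<[1+m/n]*n : ∀ m n .{{_ : NonZero n}} → m < suc (m / n) * n
m<[1+m/n]*n m n = begin-strict
  m                    ≡⟨ m≡m%n+[m/n]*n m n ⟩
  m % n + m / n * n    <⟨ +-monoˡ-< _ (m%n<n m n) ⟩
  suc (m / n) * n      ∎
  where open ≤-Reasoning

[2*m]/n≤ : ∀ m n .{{_ : NonZero n}} → (2 * m) / n ≤ 1 + 2 * (m / n)
[2*m]/n≤ m n = s≤s⁻¹ (m<n*o⇒m/o<n (begin-strict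
  2 * m                      <⟨ *-monoʳ-< 2 (m<[1+m/n]*n m n) ⟩
  2 * (suc (m / n) * n)      ≡⟨ identity (m / n) n ⟩
  suc (1 + 2 * (m / n)) * n  ∎))
  where
  open ≤-Reasoning
  identity : ∀ q n → 2 * (suc q * n) ≡ suc (1 + 2 * q) * n
  identity = solve-∀

-- The constant term of the weight absorbs the rounding of the quotient. What matters about the
-- factor is that it stays below 4, the growth of `N * N`.
weight-double : ∀ N P Q → weight (2 * N) P Q ≤ 3 * weight N P Q
weight-double N P Q = begin
  2 + 2 * ((2 * N) / D)    ≤⟨ +-monoʳ-≤ 2 (*-monoʳ-≤ 2 ([2*m]/n≤ N D)) ⟩
  2 + 2 * (1 + 2 * q)      ≤⟨ m≤m+n _ (2 + 2 * q) ⟩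
  2 + 2 * (1 + 2 * q) + (2 + 2 * q) ≡⟨ identity q ⟩
  3 * (2 + 2 * q)          ∎
  where
  open ≤-Reasoning
  D = suc (sup-norm-1 (direction (step P Q)))
  q = N / D
  identity : ∀ q → 2 + 2 * (1 + 2 * q) + (2 + 2 * q) ≡ 3 * (2 + 2 * q)
  identity = solve-∀

-- The total weight of one point against a whole box.

opaque
  unfolding ∑

  ∑-applyUpTo-+ : ∀ (g : ℕ → A) m n f → ∑ (applyUpTo g (m + n)) f ≡
                  ∑ (applyUpTo g m) f + ∑ (applyUpTo (λ i → g (m + i)) n) f
  ∑-applyUpTo-+ g zero    n f = refl
  ∑-applyUpTo-+ g (suc m) n f =
    trans (cong (λ s → f (g 0) + s) (∑-applyUpTo-+ (λ i → g (suc i)) m n f)) (sym (+-assoc (f (g 0)) _ _))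

  ∑-applyUpTo-≤ : ∀ (g : ℕ → A) n f c → (∀ i → f (g i) ≤ c) → ∑ (applyUpTo g n) f ≤ n * c
  ∑-applyUpTo-≤ g zero    f c h = z≤n
  ∑-applyUpTo-≤ g (suc n) f c h = +-mono-≤ (h 0) (∑-applyUpTo-≤ (λ i → g (suc i)) n f c (λ i → h (suc i)))

-- When `N` doubles, each quotient of the first half at most doubles, up to 1 for rounding, and each
-- of the `N` new divisors gives a quotient of at most 1. So the sum divided by the side grows by at
-- most 1 per doubling.
harmonic-≤ : ∀ k → ∑ (upTo (2 ^ k)) (λ r → 2 ^ k / suc r) ≤ 2 ^ k * suc k
harmonic-≤ zero    = ∑-applyUpTo-≤ (λ i → i) 1 _ 1 (λ i → m/n≤m 1 (suc i))
harmonic-≤ (suc k) = begin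
  ∑ (upTo (2 * N)) h                  ≡⟨ cong (λ m → ∑ (upTo (N + m)) h) (+-identityʳ N) ⟩
  ∑ (upTo (N + N)) h                  ≡⟨ ∑-applyUpTo-+ (λ i → i) N N h ⟩
  ∑ (upTo N) h + ∑ (applyUpTo (λ i → N + i) N) h
    ≤⟨ +-mono-≤ (∑-mono (upTo N) (λ {r} _ → [2*m]/n≤ N (suc r))) (∑-applyUpTo-≤ (λ i → N + i) N h 1 upper) ⟩
  ∑ (upTo N) (λ r → 1 + 2 * (N / suc r)) + N * 1
    ≡⟨ cong (_+ N * 1) (∑-distrib-+ (upTo N) (λ _ → 1) (λ r → 2 * (N / suc r))) ⟩
  ∑ (upTo N) (λ _ → 1) + ∑ (upTo N) (λ r → 2 * (N / suc r)) + N * 1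
    ≡⟨ cong₂ (λ a b → a + b + N * 1) (trans (∑-const (upTo N) 1) (cong (_* 1) (length-upTo N)))
         (trans (∑-cong (upTo N) (λ r → *-comm 2 (N / suc r))) (∑-*ʳ (upTo N) (λ r → N / suc r) 2)) ⟩
  N * 1 + ∑ (upTo N) (λ r → N / suc r) * 2 + N * 1
    ≤⟨ +-monoˡ-≤ (N * 1) (+-monoʳ-≤ (N * 1) (*-monoˡ-≤ 2 (harmonic-≤ k))) ⟩
  N * 1 + N * suc k * 2 + N * 1       ≡⟨ identity N k ⟩
  2 * N * suc (suc k)                 ∎
  where
  open ≤-Reasoning
  N = 2 ^ k
  h : ℕ → ℕ
  h r = (2 * N) / suc r
  identity : ∀ N k → N * 1 + N * suc k * 2 + N * 1 ≡ 2 * N * suc (suc k)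
  identity = solve-∀
  upper : ∀ i → h (N + i) ≤ 1
  upper i = s≤s⁻¹ (m<n*o⇒m/o<n (*-monoʳ-< 2 (s≤s (m≤m+n N i))))

-- With both values of `b`, a superset of the primitive directions of sup norm `suc r`, enough for
-- an upper bound.
slopes : Bool → ℕ → List Direction
slopes b r = map (λ e → b , r , e) (range (suc r))

directions : ℕ → List Direction
directions N = concatMap (λ r → slopes true r ++ slopes false r) (upTo N)

∈-directions : ∀ {N} d → sup-norm-1 d < N → ∣ other d ∣ ≤ suc (sup-norm-1 d) → d ∈ directions N
∈-directions {N} (b , r , e) r<N small =
  ∈-concatMap⁺ (λ r → slopes true r ++ slopes false r) {xs = upTo N} (lose (∈-upTo⁺ r<N) (either b))
  where
  either : ∀ b → (b , r , e) ∈ slopes true r ++ slopes false r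
  either true  = ∈-++⁺ˡ {ys = slopes false r} (∈-map⁺ (λ e → true , r , e) (∈-range e small))
  either false = ∈-++⁺ʳ (slopes true r) (∈-map⁺ (λ e → false , r , e) (∈-range e small))

∑-directions : ∀ N (f : ℕ → ℕ) → ∑ (directions N) (λ d → f (sup-norm-1 d)) ≡
                       ∑ (upTo N) (λ r → 2 * (4 + 2 * r) * f r)
∑-directions N f = trans (∑-concatMap (λ r → slopes true r ++ slopes false r) (upTo N) _) (∑-cong (upTo N) shell)
  where
  half-shell : ∀ b r → ∑ (slopes b r) (λ d → f (sup-norm-1 d)) ≡ (2 + 2 * suc r) * f r
  half-shell b r = trans (∑-map (λ e → b , r , e) (range (suc r)) (λ d → f (sup-norm-1 d))) (∑-range (suc r) (f r))
  identity : ∀ r c → (2 + 2 * suc r) * c + (2 + 2 * suc r) * c ≡ 2 * (4 + 2 * r) * c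
  identity = solve-∀
  shell : ∀ r → ∑ (slopes true r ++ slopes false r) (λ d → f (sup-norm-1 d)) ≡ 2 * (4 + 2 * r) * f r
  shell r = trans (∑-++ (slopes true r) (slopes false r) (λ d → f (sup-norm-1 d)))
    (trans (cong₂ _+_ (half-shell true r) (half-shell false r)) (identity r (f r)))

multiples : ℕ → Direction → List (Direction × ℤ)
multiples N d = map (λ g → d , g) (range (N / suc (sup-norm-1 d)))

steps : ℕ → List (Direction × ℤ)
steps N = concatMap (multiples N) (directions N)

-- Write `D` for `suc r` and `M` for `N / D`. There are at most `8 * D` directions of norm `D`, each
-- with at most `4 * M` multiples of weight at most `4 * M`. One factor `M` together with `D` gives
-- at most `N`, the other is left for the harmonic sum, and 128 is `8 * 4 * 4`.
∑-steps-≤ : ∀ k → ∑ (steps (2 ^ k)) (λ (d , _) → 2 + 2 * (2 ^ k / suc (sup-norm-1 d))) ≤ 2 ^ k * (2 ^ k * suc k) * 128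
∑-steps-≤ k = begin
  ∑ (steps N) (λ (d , _) → 2 + 2 * M (sup-norm-1 d))
    ≡⟨ ∑-concatMap (multiples N) (directions N) _ ⟩
  ∑ (directions N) (λ d → ∑ (multiples N d) (λ (d , _) → 2 + 2 * M (sup-norm-1 d)))
    ≡⟨ ∑-cong (directions N) (λ d → trans (∑-map (λ g → d , g) (range (M (sup-norm-1 d))) _)
                                          (∑-range (M (sup-norm-1 d)) (2 + 2 * M (sup-norm-1 d)))) ⟩
  ∑ (directions N) (λ d → (2 + 2 * M (sup-norm-1 d)) * (2 + 2 * M (sup-norm-1 d)))
    ≡⟨ ∑-directions N (λ r → (2 + 2 * M r) * (2 + 2 * M r)) ⟩
  ∑ (upTo N) (λ r → 2 * (4 + 2 * r) * ((2 + 2 * M r) * (2 + 2 * M r)))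
    ≤⟨ ∑-mono (upTo N) (λ {r} r∈ → shell r (∈-upTo⁻ r∈)) ⟩
  ∑ (upTo N) (λ r → M r * (N * 128))
    ≡⟨ ∑-*ʳ (upTo N) M (N * 128) ⟩
  ∑ (upTo N) M * (N * 128)
    ≤⟨ *-monoˡ-≤ (N * 128) (harmonic-≤ k) ⟩
  N * suc k * (N * 128)
    ≡⟨ reorder N (suc k) 128 ⟩
  N * (N * suc k) * 128 ∎
  where
  open ≤-Reasoning
  N = 2 ^ k
  M : ℕ → ℕ
  M r = N / suc r
  reorder : ∀ N s c → N * s * (N * c) ≡ N * (N * s) * c
  reorder = solve-∀
  widen₁ : ∀ r → 4 + 2 * r ≤ 4 * suc r
  widen₁ r = ≤-trans (m≤m+n (4 + 2 * r) (2 * r)) (≤-reflexive (identity r))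
    where
    identity : ∀ r → 4 + 2 * r + 2 * r ≡ 4 * suc r
    identity = solve-∀
  widen₂ : ∀ m → 1 ≤ m → 2 + 2 * m ≤ 4 * m
  widen₂ m 1≤m = ≤-trans (+-monoˡ-≤ (2 * m) (*-monoʳ-≤ 2 1≤m)) (≤-reflexive (identity m))
    where
    identity : ∀ m → 2 * m + 2 * m ≡ 4 * m
    identity = solve-∀
  collect : ∀ D m → 2 * (4 * D) * ((4 * m) * (4 * m)) ≡ m * (m * D * 128)
  collect = solve-∀
  shell : ∀ r → r < N → 2 * (4 + 2 * r) * ((2 + 2 * M r) * (2 + 2 * M r)) ≤ M r * (N * 128)
  shell r r<N = begin
    2 * (4 + 2 * r) * ((2 + 2 * M r) * (2 + 2 * M r))
      ≤⟨ *-mono-≤ (*-monoʳ-≤ 2 (widen₁ r)) (*-mono-≤ (widen₂ (M r) 1≤M) (widen₂ (M r) 1≤M)) ⟩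
    2 * (4 * suc r) * ((4 * M r) * (4 * M r))   ≡⟨ collect (suc r) (M r) ⟩
    M r * (M r * suc r * 128)                   ≤⟨ *-monoʳ-≤ (M r) (*-monoˡ-≤ 128 (m/n*n≤m N (suc r))) ⟩
    M r * (N * 128)                             ∎
    where
    1≤M : 1 ≤ M r
    1≤M = m*n≤o⇒m≤o/n 1 (suc r) (≤-trans (≤-reflexive (*-identityˡ (suc r))) r<N)

∑-weight-≤ : ∀ {xs P} k → Unique xs → (∀ {X} → X ∈ xs → InBox (2 ^ k) X) → InBox (2 ^ k) P →
             ∑ xs (λ X → weight (2 ^ k) P X) ≤ 2 ^ k * (2 ^ k * suc k) * 128
∑-weight-≤ {xs} {P} k u inB inP = ≤-trans
  (∑-cover _≟ₚ_ u _ (steps N) (λ (d , g) → along P (vector d) g) _ covered) (∑-steps-≤ k)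
  where
  N = 2 ^ k
  covered : ∀ {X} → X ∈ xs → 0 < weight N P X →
    ∃[ s ] (s ∈ steps N × X ≡ along P (vector (proj₁ s)) (proj₂ s) ×
            weight N P X ≤ 2 + 2 * (N / suc (sup-norm-1 (proj₁ s))))
  covered {X} X∈ _ = (d , g) ,
    ∈-concatMap⁺ (multiples N) {xs = directions N} (lose (∈-directions d radius (small f))
      (∈-map⁺ (λ g → d , g) (∈-range g (along-bound-/ d g inP (inB X∈) eq)))) ,
    eq , ≤-refl
    where
    f = step P X
    d = direction f
    g = multiple f
    eq = step-along P X
    -- If `X` is `P`, the multiple is zero and the box gives no bound on the norm; `unit` then
    -- supplies norm 1.
    radius : sup-norm-1 d < N
    radius with g ℤ.≟ 0ℤ
    ... | yes g≡0 = subst (_< N) (sym (unit f g≡0)) (m^n>0 2 k)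
    ... | no  g≢0 = ≤-trans (m≤n*m (suc (sup-norm-1 d)) ∣ g ∣ {{≢-nonZero (g≢0 ∘ ℤ.∣i∣≡0⇒i≡0)}})
                            (along-bound d g inP (inB X∈) eq)

-- Opaque, so that the numeral is never unfolded to a unary one.
opaque
  capacity : ℕ
  capacity = 128

  instance
    capacity-nonZero : NonZero capacity
    capacity-nonZero = _

  ∑-weight-≤-capacity : ∀ {xs P} k → Unique xs → (∀ {X} → X ∈ xs → InBox (2 ^ k) X) → InBox (2 ^ k) P →
                        ∑ xs (λ X → weight (2 ^ k) P X) ≤ 2 ^ k * (2 ^ k * suc k) * capacity
  ∑-weight-≤-capacity = ∑-weight-≤

-- General position, energy and blocked points.

collinear-swap : ∀ {P Q R} → Collinear P Q R → Collinear Q P R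
collinear-swap (a , b , c , ab≢0 , p , q , r) = a , b , c , ab≢0 , q , p , r

collinear-rotate : ∀ {P Q R} → Collinear P Q R → Collinear Q R P
collinear-rotate (a , b , c , ab≢0 , p , q , r) = a , b , c , ab≢0 , q , r , p

Clear : List Point → Point → Set
Clear F X = X ∉ F × (∀ {P Q} → P ∈ F → Q ∈ F → P ≢ Q → ¬ Collinear P Q X)

data GeneralPosition : List Point → Set where
  []  : GeneralPosition []
  _∷_ : ∀ {X F} → Clear F X → GeneralPosition F → GeneralPosition (X ∷ F)

general⇒unique : ∀ {F} → GeneralPosition F → Unique F
general⇒unique []              = []
general⇒unique ((X∉ , _) ∷ gp) = tabulate (λ Y∈ X≡Y → X∉ (subst (_∈ _) (sym X≡Y) Y∈)) ∷ general⇒unique gp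

-- Of the three points, the one nearest to the head was added last and is clear of the other two;
-- permuting the collinear triple brings it into third place.
general⇒noThree : ∀ {F P Q R} → GeneralPosition F → P ∈ F → Q ∈ F → R ∈ F →
                  P ≢ Q → P ≢ R → Q ≢ R → ¬ Collinear P Q R
general⇒noThree gp (here refl) (here refl) _           P≢Q P≢R Q≢R = ⊥-elim (P≢Q refl)
general⇒noThree gp (here refl) (there _)   (here refl) P≢Q P≢R Q≢R = ⊥-elim (P≢R refl)
general⇒noThree gp (there _)   (here refl) (here refl) P≢Q P≢R Q≢R = ⊥-elim (Q≢R refl)
general⇒noThree ((_ , clear) ∷ _) (here refl) (there Q∈) (there R∈) P≢Q P≢R Q≢R =
  clear Q∈ R∈ Q≢R ∘ collinear-rotate
general⇒noThree ((_ , clear) ∷ _) (there P∈) (here refl) (there R∈) P≢Q P≢R Q≢R =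
  clear P∈ R∈ P≢R ∘ collinear-rotate ∘ collinear-swap
general⇒noThree ((_ , clear) ∷ _) (there P∈) (there Q∈) (here refl) P≢Q P≢R Q≢R =
  clear P∈ Q∈ P≢Q
general⇒noThree (_ ∷ gp) (there P∈) (there Q∈) (there R∈) = general⇒noThree gp P∈ Q∈ R∈

-- The extra 1 per point accounts for the position which that point occupies itself, so that the
-- energy bounds the sum of `blocked`.
energy : ℕ → List Point → ℕ
energy N []      = 0
energy N (P ∷ F) = suc (∑ F (λ Q → weight N Q P)) + energy N F

energy-double : ∀ N F → energy (2 * N) F ≤ 3 * energy N F
energy-double N []      = z≤n
energy-double N (P ∷ F) = begin
  suc (∑ F (λ Q → weight (2 * N) Q P)) + energy (2 * N) F
    ≤⟨ +-mono-≤ (s≤s (∑-mono F (λ {Q} _ → ≤-trans (weight-double N Q P) (≤-reflexive (*-comm 3 (weight N Q P))))))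
                (energy-double N F) ⟩
  suc (∑ F (λ Q → weight N Q P * 3)) + 3 * energy N F
    ≡⟨ cong (λ s → suc s + 3 * energy N F) (∑-*ʳ F (λ Q → weight N Q P) 3) ⟩
  suc (∑ F (λ Q → weight N Q P) * 3) + 3 * energy N F
    ≤⟨ m≤m+n _ 2 ⟩
  suc (∑ F (λ Q → weight N Q P) * 3) + 3 * energy N F + 2
    ≡⟨ identity (∑ F (λ Q → weight N Q P)) (energy N F) ⟩
  3 * (suc (∑ F (λ Q → weight N Q P)) + energy N F) ∎
  where
  open ≤-Reasoning
  identity : ∀ s e → suc (s * 3) + 3 * e + 2 ≡ 3 * (suc s + e)
  identity = solve-∀

-- A multiplicity of obstructions rather than a predicate, so that it can be averaged over a block;
-- its vanishing certifies `Clear`.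
blocked : List Point → Point → ℕ
blocked []      X = 0
blocked (P ∷ F) X = indicator (X ≟ₚ P) + ∑ F (λ Q → indicator (cross Q P X ℤ.≟ 0ℤ)) + blocked F X

blocked≡0⇒clear : ∀ F X → blocked F X ≡ 0 → Clear F X
blocked≡0⇒clear []      X _  = (λ ()) , λ ()
blocked≡0⇒clear (P ∷ F) X eq = X∉ , clear
  where
  now : indicator (X ≟ₚ P) + ∑ F (λ Q → indicator (cross Q P X ℤ.≟ 0ℤ)) ≡ 0
  now = m+n≡0⇒m≡0 _ eq
  later : Clear F X
  later = blocked≡0⇒clear F X (m+n≡0⇒n≡0 (indicator (X ≟ₚ P) + ∑ F (λ Q → indicator (cross Q P X ℤ.≟ 0ℤ))) eq)
  X∉ : X ∉ P ∷ F
  X∉ (here X≡P) = indicator≡0⇒¬ (X ≟ₚ P) (m+n≡0⇒m≡0 _ now) X≡P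
  X∉ (there X∈) = proj₁ later X∈
  head-clear : ∀ {Q} → Q ∈ F → ¬ Collinear Q P X
  head-clear {Q} Q∈ col = indicator≡0⇒¬ (cross Q P X ℤ.≟ 0ℤ)
    (n≤0⇒n≡0 (≤-trans (∑-∈ (λ Q → indicator (cross Q P X ℤ.≟ 0ℤ)) Q∈)
                      (≤-reflexive (m+n≡0⇒n≡0 (indicator (X ≟ₚ P)) now))))
    (collinear⇒cross≡0 Q P X col)
  clear : ∀ {A B} → A ∈ P ∷ F → B ∈ P ∷ F → A ≢ B → ¬ Collinear A B X
  clear (here refl) (here refl) A≢B = ⊥-elim (A≢B refl)
  clear (here refl) (there B∈)  A≢B = head-clear B∈ ∘ collinear-swap
  clear (there A∈)  (here refl) A≢B = head-clear A∈
  clear (there A∈)  (there B∈)  A≢B = proj₂ later A∈ B∈ A≢B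

-- After exchanging the sums, the line of each pair costs at most its weight by `line-≤-weight` and
-- each chosen point at most 1, which matches `energy` term by term.
∑-blocked-≤ : ∀ {N xs} F → Unique xs → (∀ {X} → X ∈ xs → InBox N X) → (∀ {P} → P ∈ F → InBox N P) →
              GeneralPosition F → ∑ xs (blocked F) ≤ energy N F
∑-blocked-≤ {N} {xs} []      u inB inF []                = ≤-reflexive (∑-zero xs)
∑-blocked-≤ {N} {xs} (P ∷ F) u inB inF ((P∉ , _) ∷ gp) = begin
  ∑ xs (blocked (P ∷ F))
    ≡⟨ ∑-distrib-+ xs (λ X → indicator (X ≟ₚ P) + ∑ F (λ Q → indicator (cross Q P X ℤ.≟ 0ℤ))) (blocked F) ⟩
  ∑ xs (λ X → indicator (X ≟ₚ P) + ∑ F (λ Q → indicator (cross Q P X ℤ.≟ 0ℤ))) + ∑ xs (blocked F)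
    ≡⟨ cong (_+ ∑ xs (blocked F)) (∑-distrib-+ xs (λ X → indicator (X ≟ₚ P)) _) ⟩
  ∑ xs (λ X → indicator (X ≟ₚ P)) + ∑ xs (λ X → ∑ F (λ Q → indicator (cross Q P X ℤ.≟ 0ℤ))) + ∑ xs (blocked F)
    ≤⟨ +-mono-≤ (+-mono-≤ (∑-indicator-≤1 _≟ₚ_ P u) pairs) (∑-blocked-≤ F u inB (inF ∘ there) gp) ⟩
  energy N (P ∷ F) ∎
  where
  open ≤-Reasoning
  pairs : ∑ xs (λ X → ∑ F (λ Q → indicator (cross Q P X ℤ.≟ 0ℤ))) ≤ ∑ F (λ Q → weight N Q P)
  pairs = begin
    ∑ xs (λ X → ∑ F (λ Q → indicator (cross Q P X ℤ.≟ 0ℤ))) ≡⟨ ∑-swap xs F _ ⟩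
    ∑ F (λ Q → ∑ xs (λ X → indicator (cross Q P X ℤ.≟ 0ℤ)))
      ≤⟨ ∑-mono F (λ {Q} Q∈ → line-≤-weight u inB (inF (there Q∈)) (λ Q≡P → P∉ (subst (_∈ F) Q≡P Q∈))) ⟩
    ∑ F (λ Q → weight N Q P) ∎

-- The greedy choice of one point in a new block.

-- The lower right quarter of the box of side `2 * N`. Its abscissas exceed `N`, so points chosen
-- there never disturb what lies further left.
block : ℕ → List Point
block N = cartesianProductWith (λ i j → + suc (N + i) , + suc j) (upTo N) (upTo N)

block-unique : ∀ N → Unique (block N)
block-unique N = cartesianProductWith⁺ _
  (λ eq → +-cancelˡ-≡ N _ _ (suc-injective (ℤ.+-injective (cong proj₁ eq))) ,
          suc-injective (ℤ.+-injective (cong proj₂ eq)))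
  (upTo⁺ N) (upTo⁺ N)

∈-block⁻ : ∀ {N X} → X ∈ block N → InBox (2 * N) X × N < ∣ proj₁ X ∣
∈-block⁻ {N} X∈ with ∈-cartesianProductWith⁻ (λ i j → + suc (N + i) , + suc j) (upTo N) (upTo N) X∈
... | i , j , i∈ , j∈ , refl =
  (N + i , j , refl ,
   subst (N + i <_) (cong (λ n → N + n) (sym (+-identityʳ N))) (+-monoʳ-< N (∈-upTo⁻ i∈)) ,
   <-≤-trans (∈-upTo⁻ j∈) (m≤m+n N _)) ,
  s≤s (m≤m+n N i)

length-block : ∀ N → length (block N) ≡ N * N
length-block N = begin
  length (block N)                          ≡⟨ *-identityʳ _ ⟨
  length (block N) * 1                      ≡⟨ ∑-const (block N) 1 ⟨
  ∑ (block N) (λ _ → 1)                     ≡⟨ ∑-cartesianProductWith _ (upTo N) (upTo N) (λ _ → 1) ⟩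
  ∑ (upTo N) (λ _ → ∑ (upTo N) (λ _ → 1))   ≡⟨ ∑-const (upTo N) _ ⟩
  length (upTo N) * ∑ (upTo N) (λ _ → 1)    ≡⟨ cong (length (upTo N) *_) (∑-const (upTo N) 1) ⟩
  length (upTo N) * (length (upTo N) * 1)   ≡⟨ cong (λ l → l * (l * 1)) (length-upTo N) ⟩
  N * (N * 1)                               ≡⟨ cong (N *_) (*-identityʳ N) ⟩
  N * N                                     ∎
  where open ≡-Reasoning

-- Summed over the `N * N` points of the block, the weights to `m` chosen points are at most
-- `4 * (N * N) * capacity * (m * (2 + j))`, the box having side `2 * N`. The threshold exceeds
-- twice the resulting average, and `suc m` keeps it positive when nothing has been chosen.
threshold : ℕ → ℕ → ℕ
threshold j m = capacity * 16 * (suc m * (2 + j))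

m*n<n⇒m≡0 : ∀ m {n} → m * n < n → m ≡ 0
m*n<n⇒m≡0 zero    _  = refl
m*n<n⇒m≡0 (suc m) lt = ⊥-elim (<-irrefl refl (≤-<-trans (m≤m+n _ _) lt))

-- Each obstruction is fined `γ` on top of the added weight. The fines use at most half of the
-- allowance `N * N * γ` by the energy hypothesis, the weights less than half by the size of
-- `threshold`, so some point costs less than `γ`. Such a point has no obstruction, and its added
-- weight is below `γ`.
choose : ∀ j F → GeneralPosition F → (∀ {P} → P ∈ F → InBox (2 ^ suc j) P) →
         2 * energy (2 ^ suc j) F ≤ 2 ^ j * 2 ^ j →
         ∃[ X ] (X ∈ block (2 ^ j) × Clear F X × suc (∑ F (λ P → weight (2 ^ suc j) P X)) ≤ threshold j (length F))
choose j F gp inF cheap =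
  let X , X∈ , below = ∃-below-average (block N) cost γ (*-cancelˡ-< 2 _ _ average)
  in X , X∈ ,
     blocked≡0⇒clear F X (m*n<n⇒m≡0 (blocked F X) (≤-<-trans (m≤m+n _ _) below)) ,
     ≤-<-trans (m≤n+m _ (blocked F X * γ)) below
  where
  open ≤-Reasoning
  N = 2 ^ j
  L = 2 ^ suc j
  m = length F
  γ = threshold j m
  cost : Point → ℕ
  cost X = blocked F X * γ + ∑ F (λ P → weight L P X)
  rearrange : ∀ n c m j → 2 * (m * (2 * n * (2 * n * (2 + j)) * c)) ≡ n * n * (c * 8 * (m * (2 + j)))
  rearrange = solve-∀
  double : ∀ n c m j → n * n * (c * 16 * (suc m * (2 + j))) + n * n * (c * 16 * (suc m * (2 + j))) ≡
                       2 * (n * n * (c * 16 * (suc m * (2 + j))))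
  double = solve-∀
  instance
    N-nonZero : NonZero N
    N-nonZero = m^n≢0 2 j
    N*N-nonZero : NonZero (N * N)
    N*N-nonZero = m*n≢0 N N
    c8-nonZero : NonZero (capacity * 8)
    c8-nonZero = m*n≢0 capacity 8
  smaller : capacity * 8 * (m * (2 + j)) < γ
  smaller = <-≤-trans (*-monoʳ-< (capacity * 8) (m<n+m (m * (2 + j)) {2 + j} z<s))
                      (*-monoˡ-≤ (suc m * (2 + j)) (*-monoʳ-≤ capacity (m≤m+n 8 8)))
  energies : ∑ (block N) (λ X → ∑ F (λ P → weight L P X)) ≤ m * (L * (L * (2 + j)) * capacity)
  energies = begin
    ∑ (block N) (λ X → ∑ F (λ P → weight L P X)) ≡⟨ ∑-swap (block N) F _ ⟩
    ∑ F (λ P → ∑ (block N) (λ X → weight L P X))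
      ≤⟨ ∑-mono F (λ P∈ → ∑-weight-≤-capacity (suc j) (block-unique N) (proj₁ ∘ ∈-block⁻ {N}) (inF P∈)) ⟩
    ∑ F (λ _ → L * (L * (2 + j)) * capacity)     ≡⟨ ∑-const F _ ⟩
    m * (L * (L * (2 + j)) * capacity)           ∎
  average : 2 * ∑ (block N) cost < 2 * (length (block N) * γ)
  average = begin-strict
    2 * ∑ (block N) cost
      ≡⟨ cong (2 *_) (trans (∑-distrib-+ (block N) _ _) (cong (λ s → s + ∑ (block N) (λ X → ∑ F (λ P → weight L P X))) (∑-*ʳ (block N) (blocked F) γ))) ⟩
    2 * (∑ (block N) (blocked F) * γ + ∑ (block N) (λ X → ∑ F (λ P → weight L P X)))
      ≤⟨ *-monoʳ-≤ 2 (+-mono-≤ (*-monoˡ-≤ γ (∑-blocked-≤ F (block-unique N) (proj₁ ∘ ∈-block⁻ {N}) inF gp)) energies) ⟩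
    2 * (energy L F * γ + m * (L * (L * (2 + j)) * capacity))
      ≡⟨ *-distribˡ-+ 2 (energy L F * γ) _ ⟩
    2 * (energy L F * γ) + 2 * (m * (L * (L * (2 + j)) * capacity))
      ≡⟨ cong₂ _+_ (sym (*-assoc 2 (energy L F) γ)) (rearrange N capacity m j) ⟩
    2 * energy L F * γ + N * N * (capacity * 8 * (m * (2 + j)))
      <⟨ +-mono-≤-< (*-monoˡ-≤ γ cheap) (*-monoʳ-< (N * N) smaller) ⟩
    N * N * γ + N * N * γ
      ≡⟨ double N capacity m j ⟩
    2 * (N * N * γ)
      ≡⟨ cong (λ l → 2 * (l * γ)) (length-block N) ⟨
    2 * (length (block N) * γ) ∎

-- Stages: filling a box and passing to the next one.

-- One chosen point costs at most threshold j m = 16 capacity (m + 1) (j + 2), and m² grows by at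
-- least m + 1, whence the factor 8 * 16 = 128.
rate : ℕ → ℕ
rate j = capacity * 128 * (2 + j)

-- In `budget`, the term `3 * (2 ^ j * 2 ^ j)` allows for energy inherited from smaller boxes, and
-- the quadratic term pays for additions in the present box.
record Stage (j : ℕ) (F : List Point) : Set where
  field
    inBox   : ∀ {P} → P ∈ F → InBox (2 ^ suc j) P
    general : GeneralPosition F
    budget  : 8 * energy (2 ^ suc j) F ≤ 3 * (2 ^ j * 2 ^ j) + rate j * (length F * length F)

-- Keeps the quadratic term of `budget` within `N * N`, where `N` is `2 ^ j`; then 8 times the
-- energy is at most `4 * (N * N)`, as `choose` requires. It allows `m` of order `N / √ j`.
Fits : ℕ → ℕ → Set
Fits j m = rate j * (m * m) ≤ 2 ^ j * 2 ^ j

-- The field `beyond` is what lets membership in the union of all stages be decided at a finite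
-- stage.
record Extends (j : ℕ) (F G : List Point) : Set where
  field
    keeps  : ∀ {X} → X ∈ F → X ∈ G
    beyond : ∀ {X} → X ∈ G → X ∈ F ⊎ 2 ^ j < ∣ proj₁ X ∣

fits-pred : ∀ {j} m → Fits j (suc m) → Fits j m
fits-pred {j} m = ≤-trans (*-monoʳ-≤ (rate j) (*-mono-≤ (n≤1+n m) (n≤1+n m)))

extend : ∀ {j F} → Stage j F → Fits j (suc (length F)) → ∃[ X ] (Stage j (X ∷ F) × 2 ^ j < ∣ proj₁ X ∣)
extend {j} {F} st fits = X , record
  { inBox   = λ { (here refl) → proj₁ (∈-block⁻ {N} X∈) ; (there P∈) → inBox P∈ }
  ; general = clear ∷ general
  ; budget  = begin
      8 * (inc + E)                                   ≡⟨ *-distribˡ-+ 8 inc E ⟩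
      8 * inc + 8 * E                                 ≤⟨ +-mono-≤ (*-monoʳ-≤ 8 inc≤) budget ⟩
      8 * threshold j m + (3 * (N * N) + rate j * (m * m))
        ≤⟨ m≤m+n _ (rate j * m) ⟩
      8 * threshold j m + (3 * (N * N) + rate j * (m * m)) + rate j * m
        ≡⟨ identity capacity j m (N * N) ⟩
      3 * (N * N) + rate j * (suc m * suc m)          ∎
  } , proj₂ (∈-block⁻ {N} X∈)
  where
  open ≤-Reasoning
  open Stage st
  N = 2 ^ j
  m = length F
  E = energy (2 ^ suc j) F
  cheap : 2 * E ≤ N * N
  cheap = *-cancelˡ-≤ 4 (begin
    4 * (2 * E)                       ≡⟨ *-assoc 4 2 E ⟨
    8 * E                             ≤⟨ budget ⟩
    3 * (N * N) + rate j * (m * m)    ≤⟨ +-monoʳ-≤ (3 * (N * N)) (fits-pred m fits) ⟩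
    3 * (N * N) + N * N               ≡⟨ +-comm (3 * (N * N)) (N * N) ⟩
    4 * (N * N)                       ∎)
  choice = choose j F general inBox cheap
  X = proj₁ choice
  X∈ = proj₁ (proj₂ choice)
  clear = proj₁ (proj₂ (proj₂ choice))
  inc = suc (∑ F (λ P → weight (2 ^ suc j) P X))
  inc≤ : inc ≤ threshold j m
  inc≤ = proj₂ (proj₂ (proj₂ choice))
  identity : ∀ c j m n → 8 * (c * 16 * (suc m * (2 + j))) + (3 * n + c * 128 * (2 + j) * (m * m)) + c * 128 * (2 + j) * m
                       ≡ 3 * n + c * 128 * (2 + j) * (suc m * suc m)
  identity = solve-∀

grow : ∀ {j F} r → Stage j F → Fits j (r + length F) →
       Σ[ G ∈ List Point ] (Stage j G × Extends j F G × length G ≡ r + length F)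
grow zero    st _ = _ , st , record { keeps = λ X∈ → X∈ ; beyond = inj₁ } , refl
grow {j} {F} (suc r) st fits =
  let G , stG , ext , len = grow r st (fits-pred (r + length F) fits)
      open Extends ext
      X , stX , far = extend stG (subst (Fits j ∘ suc) (sym len) fits)
  in X ∷ G , stX ,
     record { keeps  = there ∘ keeps
            ; beyond = λ { (here refl) → inj₂ far ; (there Y∈) → beyond Y∈ } } ,
     cong suc len

-- Before doubling, 8 times the energy is at most `4 * (N * N)`, which is `L * L`; doubling the side
-- multiplies it by at most 3. The inherited part `3 * (L * L)` of the new budget therefore covers
-- everything carried over.
next : ∀ {j F} → Stage j F → Fits j (length F) → Stage (suc j) F
next {j} {F} st fits = record
  { inBox   = λ P∈ → let i , i′ , eq , i< , i′< = inBox P∈ in i , i′ , eq , ≤-trans i< widen , ≤-trans i′< widen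
  ; general = general
  ; budget  = begin
      8 * energy (2 * L) F                        ≤⟨ *-monoʳ-≤ 8 (energy-double L F) ⟩
      8 * (3 * energy L F)                        ≡⟨ commute (energy L F) ⟩
      3 * (8 * energy L F)                        ≤⟨ *-monoʳ-≤ 3 (≤-trans budget (+-monoʳ-≤ (3 * (N * N)) fits)) ⟩
      3 * (3 * (N * N) + N * N)                   ≡⟨ identity N ⟩
      3 * (L * L)                                 ≤⟨ m≤m+n _ _ ⟩
      3 * (L * L) + rate (suc j) * (length F * length F) ∎
  }
  where
  open ≤-Reasoning
  open Stage st
  N = 2 ^ j
  L = 2 ^ suc j
  widen : L ≤ 2 * L
  widen = m≤n*m L 2
  commute : ∀ e → 8 * (3 * e) ≡ 3 * (8 * e)
  commute = solve-∀
  identity : ∀ n → 3 * (3 * (n * n) + n * n) ≡ 3 * (2 * n * (2 * n))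
  identity = solve-∀

integer-sqrt : ∀ b .{{_ : NonZero b}} n → ∃[ m ] (b * (m * m) ≤ n × n < b * (suc m * suc m))
integer-sqrt b zero    = 0 , ≤-reflexive (*-zeroʳ b) , >-nonZero⁻¹ _ {{m*n≢0 b 1}}
integer-sqrt b (suc n) with integer-sqrt b n
... | m , below , above with b * (suc m * suc m) ≤? suc n
...   | yes le = suc m , le ,
                 ≤-<-trans above (*-monoʳ-< b (*-mono-< (n<1+n (suc m)) (n<1+n (suc m))))
...   | no ¬le = m , m≤n⇒m≤1+n below , ≰⇒> ¬le

instance
  rate-nonZero : ∀ {j} → NonZero (rate j)
  rate-nonZero {j} = m*n≢0 (capacity * 128) (2 + j) {{m*n≢0 capacity 128}}

-- The last condition is maximality: one further point would no longer fit. It is the source of the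
-- density bound.
Full : ℕ → List Point → Set
Full j F = Stage j F × Fits j (length F) × 2 ^ j * 2 ^ j < rate j * (suc (length F) * suc (length F))

fill : ∀ {j F} → Stage j F → Fits j (length F) → Σ[ G ∈ List Point ] (Full j G × Extends j F G)
fill {j} {F} st fits with integer-sqrt (rate j) (2 ^ j * 2 ^ j)
... | M , below , above =
  let G , stG , ext , len = grow (M ∸ length F) st (subst (Fits j) (sym M≡) below)
      len′ = trans len M≡
  in G , (stG , subst (Fits j) (sym len′) below ,
          subst (λ m → 2 ^ j * 2 ^ j < rate j * (suc m * suc m)) (sym len′) above) , ext
  where
  -- `F` itself fits, so the largest fitting size is at least its length and the truncated
  -- subtraction is exact.
  not-larger : ¬ (M < length F)
  not-larger M<m = <-irrefl refl (<-≤-trans above (≤-trans (*-monoʳ-≤ (rate j) (*-mono-≤ M<m M<m)) fits))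
  M≡ : M ∸ length F + length F ≡ M
  M≡ = m∸n+n≡m (≮⇒≥ not-larger)

-- The allowance grows by the factor 4 and `rate` by no more, since `3 + j ≤ 4 * (2 + j)`.
fits-suc : ∀ {j} m → Fits j m → Fits (suc j) m
fits-suc {j} m fits = begin
  rate (suc j) * (m * m)                        ≤⟨ m≤m+n _ _ ⟩
  rate (suc j) * (m * m) + capacity * 128 * (5 + 3 * j) * (m * m) ≡⟨ identity (capacity * 128) j (m * m) ⟩
  4 * (rate j * (m * m))                        ≤⟨ *-monoʳ-≤ 4 fits ⟩
  4 * (2 ^ j * 2 ^ j)                           ≡⟨ square (2 ^ j) ⟩
  2 ^ suc j * 2 ^ suc j                         ∎
  where
  open ≤-Reasoning
  identity : ∀ c j s → c * (3 + j) * s + c * (5 + 3 * j) * s ≡ 4 * (c * (2 + j) * s)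
  identity = solve-∀
  square : ∀ n → 4 * (n * n) ≡ 2 * n * (2 * n)
  square = solve-∀

-- The tower of stages and its union.

empty-stage : Stage 0 []
empty-stage = record { inBox = λ () ; general = [] ; budget = z≤n }

empty-fits : Fits 0 0
empty-fits = ≤-trans (≤-reflexive (*-zeroʳ (rate 0))) z≤n

extension : ∀ {j F} → Full j F → Σ[ G ∈ List Point ] (Full (suc j) G × Extends (suc j) F G)
extension {F = F} (st , fits , _) = fill (next st fits) (fits-suc (length F) fits)

tower : ∀ j → Σ[ F ∈ List Point ] Full j F
tower zero    = let G , full , _ = fill empty-stage empty-fits in G , full
tower (suc j) = let G , full , _ = extension (proj₂ (tower j)) in G , full

points : ℕ → List Point
points j = proj₁ (tower j)

points-extends : ∀ j → Extends (suc j) (points j) (points (suc j))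
points-extends j = proj₂ (proj₂ (extension (proj₂ (tower j))))

points-mono : ∀ {j X} k → X ∈ points j → X ∈ points (k + j)
points-mono zero    X∈ = X∈
points-mono (suc k) X∈ = Extends.keeps (points-extends (k + _)) (points-mono k X∈)

n<2^n : ∀ n → n < 2 ^ n
n<2^n zero    = z<s
n<2^n (suc n) = begin-strict
  suc n          <⟨ s<s (n<2^n n) ⟩
  1 + 2 ^ n      ≤⟨ +-monoˡ-≤ (2 ^ n) (m^n>0 2 n) ⟩
  2 ^ n + 2 ^ n  ≡⟨ cong (λ m → 2 ^ n + m) (+-identityʳ (2 ^ n)) ⟨
  2 ^ suc n      ∎
  where open ≤-Reasoning

-- A point entering at stage `suc (k + a)` has abscissa above `2 ^ suc (k + a)` in absolute value,
-- hence above `a`. A point with smaller abscissa can thus be traced down to stage `a`.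
points-settled : ∀ {X} a k → ∣ proj₁ X ∣ ≤ a → X ∈ points (k + a) → X ∈ points a
points-settled a zero    _   X∈ = X∈
points-settled {X} a (suc k) x≤a X∈ with Extends.beyond (points-extends (k + a)) X∈
... | inj₁ X∈′ = points-settled a k x≤a X∈′
... | inj₂ far = ⊥-elim (<-asym far (≤-<-trans x≤a (≤-<-trans
      (≤-trans (m≤n+m a k) (n≤1+n (k + a))) (n<2^n (suc k + a)))))

-- From stage j on, every new point has abscissa above 2 ^ j > j, so stage ∣ x ∣ decides membership.
greedy : Subset²
greedy X = does (X ∈? points ∣ proj₁ X ∣)

greedy⇒∈ : ∀ X → greedy X ≡ true → X ∈ points ∣ proj₁ X ∣
greedy⇒∈ X eq with X ∈? points ∣ proj₁ X ∣
... | yes X∈ = X∈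
... | no  _  with eq
...   | ()

∈⇒greedy : ∀ {j X} → X ∈ points j → greedy X ≡ true
∈⇒greedy {j} {X} X∈ = dec-true (X ∈? points a)
  (points-settled a j ≤-refl (subst (λ i → X ∈ points i) (+-comm a j) (points-mono a X∈)))
  where a = ∣ proj₁ X ∣

-- The three points lie in the common stage `p + (q + r)`, which is in general position.
greedy-noThree : NoThreeInLine greedy
greedy-noThree P Q R SP SQ SR = general⇒noThree (Stage.general (proj₁ (proj₂ (tower (p + (q + r))))))
  (subst (λ i → P ∈ points i) (+-comm (q + r) p) (points-mono (q + r) (greedy⇒∈ P SP)))
  (subst (λ i → Q ∈ points i) (trans (+-assoc p r q) (cong (λ i → p + i) (+-comm r q)))
         (points-mono (p + r) (greedy⇒∈ Q SQ)))
  (subst (λ i → R ∈ points i) (+-assoc p q r) (points-mono (p + q) (greedy⇒∈ R SR)))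
  where
  p = ∣ proj₁ P ∣
  q = ∣ proj₁ Q ∣
  r = ∣ proj₁ R ∣

-- Counting and the density bound.

opaque
  unfolding ∑

  count-∑ : ∀ S n → count S n ≡
            ∑ (cartesianProductWith (λ i j → + i , + j) [ n ] [ n ]) (λ X → if S X then 1 else 0)
  count-∑ S n = sym (∑-cartesianProductWith (λ i j → + i , + j) [ n ] [ n ] (λ X → if S X then 1 else 0))

length≤count : ∀ {j n} → 2 ^ suc j ≤ n → length (points j) ≤ count greedy n
length≤count {j} {n} L≤n = begin
  length (points j)            ≡⟨ *-identityʳ _ ⟨
  length (points j) * 1        ≡⟨ ∑-const (points j) 1 ⟨
  ∑ (points j) (λ _ → 1)
    ≤⟨ ∑-cover _≟ₚ_ (general⇒unique general) _ square (λ X → X) (λ X → if greedy X then 1 else 0)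
         (λ {X} X∈ _ → X , ∈-square (inBox X∈) , refl ,
           ≤-reflexive (sym (cong (λ b → if b then 1 else 0) (∈⇒greedy {j} X∈)))) ⟩
  ∑ square (λ X → if greedy X then 1 else 0) ≡⟨ count-∑ greedy n ⟨
  count greedy n               ∎
  where
  open ≤-Reasoning
  open Stage (proj₁ (proj₂ (tower j)))
  square : List Point
  square = cartesianProductWith (λ i j → + i , + j) [ n ] [ n ]
  ∈-square : ∀ {X} → InBox (2 ^ suc j) X → X ∈ square
  ∈-square (a , b , refl , a< , b<) = ∈-cartesianProductWith⁺ (λ i j → + i , + j)
    (∈-map⁺ suc (∈-upTo⁺ (<-≤-trans a< L≤n))) (∈-map⁺ suc (∈-upTo⁺ (<-≤-trans b< L≤n)))

-- Maximality bounds `N * N` by `rate j * (suc m * suc m)`. The hypothesis `large` excludes `m = 0`,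
-- so `suc m ≤ 2 * m`; together with `2 + j ≤ 2 * suc j` this costs the factor 8.
points-density : ∀ j → rate j ≤ 2 ^ j * 2 ^ j →
                 2 ^ j * 2 ^ j ≤ capacity * 128 * 8 * (suc j * (length (points j) * length (points j)))
points-density j large with length (points j) | proj₂ (proj₂ (proj₂ (tower j)))
... | zero      | maximal = ⊥-elim (<-irrefl refl (<-≤-trans maximal (≤-trans (≤-reflexive (*-identityʳ (rate j))) large)))
... | m@(suc l) | maximal = begin
  2 ^ j * 2 ^ j                              ≤⟨ <⇒≤ maximal ⟩
  rate j * (suc m * suc m)                   ≤⟨ *-mono-≤ (*-monoʳ-≤ (capacity * 128) widen-j) (*-mono-≤ widen-m widen-m) ⟩
  capacity * 128 * (2 * suc j) * (2 * m * (2 * m))  ≡⟨ identity (capacity * 128) (suc j) m ⟩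
  capacity * 128 * 8 * (suc j * (m * m))     ∎
  where
  open ≤-Reasoning
  widen-j : 2 + j ≤ 2 * suc j
  widen-j = ≤-trans (+-monoʳ-≤ 2 (m≤n*m j 2)) (≤-reflexive (sym (*-suc 2 j)))
  widen-m : suc m ≤ 2 * m
  widen-m = ≤-trans (+-monoʳ-≤ 2 (m≤n*m l 2)) (≤-reflexive (sym (*-suc 2 l)))
  identity : ∀ c k m → c * (2 * k) * (2 * m * (2 * m)) ≡ c * 8 * (k * (m * m))
  identity = solve-∀

-- Once `j` exceeds `K`, one exponential factor dominates `K` and the other dominates the linear
-- factor `2 + j`.
rate-≤ : ∀ i → rate (suc (capacity * 128 + i)) ≤ 2 ^ suc (capacity * 128 + i) * 2 ^ suc (capacity * 128 + i)
rate-≤ i = begin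
  K * (3 + (K + i))            ≤⟨ *-mono-≤ (≤-trans (m≤m+n K i) (<⇒≤ (n<2^n (K + i)))) three ⟩
  M * (4 * M)                  ≡⟨ identity M ⟩
  2 * M * (2 * M)              ∎
  where
  open ≤-Reasoning
  K = capacity * 128
  M = 2 ^ (K + i)
  three : 3 + (K + i) ≤ 4 * M
  three = begin
    3 + (K + i)      ≤⟨ +-monoʳ-≤ 3 (<⇒≤ (n<2^n (K + i))) ⟩
    3 + M            ≤⟨ +-monoˡ-≤ M (*-monoʳ-≤ 3 (m^n>0 2 (K + i))) ⟩
    3 * M + M        ≡⟨ +-comm (3 * M) M ⟩
    4 * M            ∎
  identity : ∀ m → m * (4 * m) ≡ 2 * m * (2 * m)
  identity = solve-∀

dyadic : ∀ a n → 2 ^ a ≤ n → ∃[ i ] (2 ^ (a + i) ≤ n × n < 2 * 2 ^ (a + i))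
dyadic a zero    le = ⊥-elim (<-irrefl refl (<-≤-trans (m^n>0 2 a) le))
dyadic a (suc n) le with 2 ^ a ≤? n
-- Here `suc n` is exactly `2 ^ a`.
... | no  ≰n = 0 , subst (λ e → 2 ^ e ≤ suc n) (sym (+-identityʳ a)) le ,
  subst (λ e → suc n < 2 * 2 ^ e) (sym (+-identityʳ a))
    (≤-<-trans (≰⇒> ≰n) (m<2*m (2 ^ a) (m^n>0 2 a)))
  where
  m<2*m : ∀ m → 0 < m → m < 2 * m
  m<2*m m 0<m = m<m+n m (≤-trans 0<m (m≤m+n m 0))
... | yes ≤n with dyadic a n ≤n
...   | i , below , above with 2 * 2 ^ (a + i) ≤? suc n
...     | no  >n = i , m≤n⇒m≤1+n below , ≰⇒> >n
...     | yes ≤n′ = suc i , subst (λ e → 2 ^ e ≤ suc n) (sym (+-suc a i)) ≤n′ ,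
  subst (λ e → suc n < 2 * 2 ^ e) (sym (+-suc a i))
    (≤-<-trans above (m<m+n (2 * 2 ^ (a + i)) (≤-trans (m^n>0 2 (suc (a + i))) (m≤m+n _ 0))))

-- Squaring `n < 4 * N` gives the factor 16, and 16 times the 8 of `points-density` is 128.
count-density : ∀ j n → rate j ≤ 2 ^ j * 2 ^ j → 2 ^ suc j ≤ n → n < 2 * 2 ^ suc j →
                n * n ≤ suc j * (capacity * 128 * 128 * (count greedy n * count greedy n))
count-density j n large L≤n n<2L = begin
  n * n                                       ≤⟨ *-mono-≤ (<⇒≤ n<2L) (<⇒≤ n<2L) ⟩
  2 * (2 * N) * (2 * (2 * N))                 ≡⟨ square N ⟩
  16 * (N * N)                                ≤⟨ *-monoʳ-≤ 16 (points-density j large) ⟩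
  16 * (capacity * 128 * 8 * (suc j * (m * m)))
    ≤⟨ *-monoʳ-≤ 16 (*-monoʳ-≤ (capacity * 128 * 8) (*-monoʳ-≤ (suc j) (*-mono-≤ m≤ m≤))) ⟩
  16 * (capacity * 128 * 8 * (suc j * (c * c)))  ≡⟨ reorder (capacity * 128) (suc j) (c * c) ⟩
  suc j * (capacity * 128 * 128 * (c * c))    ∎
  where
  open ≤-Reasoning
  N = 2 ^ j
  m = length (points j)
  c = count greedy n
  m≤ : m ≤ c
  m≤ = length≤count {j} L≤n
  square : ∀ n → 2 * (2 * n) * (2 * (2 * n)) ≡ 16 * (n * n)
  square = solve-∀
  reorder : ∀ k j s → 16 * (k * 8 * (j * s)) ≡ j * (k * 128 * s)
  reorder = solve-∀

-- The density bound in integer form: taking logarithms, the last inequality reads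
-- `p * n² * log 2 ≤ q * count² * log n`, that is, `count ≥ c * n / √ (log n)` with
-- `c = √ (p * log 2 / q)`.
theorem1p1 : ∃[ p ] ∃[ q ] ∃[ n₀ ] Σ Subset² λ S →
    NonZero p × NonZero q × NoThreeInLine S ×
    (∀ n → n₀ ≤ n → 2 ^ (p * (n * n)) ≤ n ^ (q * (count S n * count S n)))
theorem1p1 = 1 , q , 2 ^ a , greedy , _ , m*n≢0 (capacity * 128) 128 {{m*n≢0 capacity 128}} , greedy-noThree , bound
  where
  open ≤-Reasoning
  -- With this `a`, the exponent `a + i` equals `suc j` for the `j` below: the dyadic interval of
  -- `n` starts at the side of the box of stage `j`, and `j` is large enough for `rate-≤`.
  a = 2 + capacity * 128
  q = capacity * 128 * 128
  bound : ∀ n → 2 ^ a ≤ n → 2 ^ (1 * (n * n)) ≤ n ^ (q * (count greedy n * count greedy n))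
  bound n n₀≤n =
    let i , below , above = dyadic a n n₀≤n
        j = suc (capacity * 128 + i)
        e = q * (count greedy n * count greedy n)
    in begin
      2 ^ (1 * (n * n))  ≤⟨ ^-monoʳ-≤ 2 (≤-trans (≤-reflexive (*-identityˡ (n * n)))
                                                 (count-density j n (rate-≤ i) below above)) ⟩
      2 ^ (suc j * e)    ≡⟨ ^-*-assoc 2 (suc j) e ⟨
      -- The logarithm enters here: `suc j` is at most the binary logarithm of `n`.
      (2 ^ suc j) ^ e    ≤⟨ ^-monoˡ-≤ e below ⟩
      n ^ e              ∎
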